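{- The following four statements are equivalent: (1) there is a function $f$ such that for all integers $s,q\ge 1$, every separated $s$-stack $q$-queue graph has queue number at most $f(s,q)$; (2) there is a function $f$ such that for all integers $s,q\ge 1$, every separated $s$-stack $q$-queue layout of a bipartite graph $G=(A\cup B,E)$ with bipartition $(A,B)$ and $|A|=|B|$ can be transformed into a separated $f(s,q)$-queue layout of $G$ by applying the same permutation to $A$ and $B$; (3) there is a function $f$ such that for every integer $q\ge 1$, every separated $1$-stack $q$-queue graph has queue number at most $f(q)$; (4) there is a constant $C$ such that every separated $1$-stack $6$-queue graph has queue number at most $C$. (The functions $f$ in different items are not required to be related.)
   Context: All graphs are simple, undirected, finite, and have at least one edge. Let $G=(V,E)$ be a graph and $\sigma$ a total order of $V$ (a vertex order). Two edges cross in $\sigma$ if their endvertices can be named $(u,v)$ and $(x,y)$ so that $u<_\sigma x<_\sigma v<_\sigma y$. Two edges nest in $\sigma$ if their endvertices can be named $(u,v)$ and $(x,y)$ so that $u<_\sigma x<_\sigma y<_\sigma v$. A stack (with respect to $\sigma$) is a set of edges no two of which cross; a queue is a set of edges no two of which nest. A $q$-queue layout ($q\ge 1$) of $G$ is a vertex order together with a partition of $E$ into $q$ queues; an $s$-stack $q$-queue layout ($s,q\ge 1$) is a vertex order together with a partition of $E$ into $s$ stacks and $q$ queues. Parts of these partitions are allowed to be empty. The queue number $\mathrm{qn}(G)$ is the minimum $q$ such that $G$ admits a $q$-queue layout. $(A,B)$ is a bipartition of $G$ if $A\cap B=\emptyset$, $A\cup B=V$ and both $G[A]$ and $G[B]$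 are edgeless. A vertex order of a bipartite graph with bipartition $(A,B)$ is separated if all vertices of $A$ precede all vertices of $B$ (or vice versa). A layout is separated if its vertex order is separated. A separated $s$-stack $q$-queue graph is a bipartite graph admitting a separated $s$-stack $q$-queue layout. Suppose $|A|=|B|=n$ and a separated layout orders $A$ as $u_1,\dots,u_n$ and $B$ as $v_1,\dots,v_n$. That the layout can be transformed into a separated $k$-queue layout by applying the same permutation to $A$ and $B$ means: there is a permutation $\pi$ of $\{1,\dots,n\}$ such that $G$ has a $k$-queue layout with vertex order $u_{\pi(1)},\dots,u_{\pi(n)},v_{\pi(1)},\dots,v_{\pi(n)}$. -}

module Defs where

open import Data.Fin as Fin using (Fin)
open import Data.Fin.Permutation using (Permutation′; _⟨$⟩ʳ_)
open import Data.Nat using (ℕ; _≤_)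
open import Data.Product using (Σ-syntax; ∃-syntax; _×_; _,_)
open import Data.Sum using (_⊎_; inj₁; inj₂)
open import Data.Vec.Functional using (Vector; _++_)
open import Function.Base using (_∘_)
open import Function.Bundles using (_↔_)
open import Level using (0ℓ)
open import Relation.Binary.Core using (Rel)
open import Relation.Binary.Definitions using (Decidable; Irreflexive; Symmetric)
open import Relation.Binary.PropositionalEquality using (_≡_)
open import Relation.Binary.Structures using (IsStrictTotalOrder)
open import Relation.Nullary using (¬_)
open import Relation.Unary using (Pred; _∈_; _∩_; _∪_; Empty; Universal; U)

record Graph : Set₁ where
  field
    V        : Set
    size     : ℕ
    finite   : V ↔ Fin size
    _~_      : Rel V 0ℓ
    ~-dec    : Decidable _~_
    ~-sym    : Symmetric _~_
    ~-irrefl : Irreflexive _≡_ _~_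
    has-edge : ∃[ u ] ∃[ v ] u ~ v

record VertexOrder (V : Set) : Set₁ where
  field
    _<_                : Rel V 0ℓ
    isStrictTotalOrder : IsStrictTotalOrder _≡_ _<_

module _ {V : Set} (σ : VertexOrder V) where
  open VertexOrder σ

  Crosses : V × V → V × V → Set
  Crosses (u , v) (x , y) = u < x × x < v × v < y

  Nests : V × V → V × V → Set
  Nests (u , v) (x , y) = u < x × x < y × y < v

  -- A set of edges is a symmetric relation.  Ranging over all ordered pairs
  -- in it therefore accounts for every naming of the endvertices.
  IsStack : Rel V 0ℓ → Set
  IsStack S = ∀ {u v x y} → S u v → S x y → ¬ Crosses (u , v) (x , y)

  IsQueue : Rel V 0ℓ → Set
  IsQueue S = ∀ {u v x y} → S u v → S x y → ¬ Nests (u , v) (x , y)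

  -- w 0 , … , w (n - 1) are exactly the elements of S, in increasing order;
  -- in particular S has cardinality n.
  record ListsInOrder (S : Pred V 0ℓ) {n : ℕ} (w : Vector V n) : Set where
    field
      increasing : ∀ {i j} → i Fin.< j → w i < w j
      sound      : ∀ i → w i ∈ S
      complete   : ∀ {x} → x ∈ S → ∃[ i ] w i ≡ x

module _ (G : Graph) where
  open Graph G

  -- A partition of the edge set into (possibly empty) parts indexed by I.
  -- The value of partOf on non-adjacent pairs plays no role.
  record EdgePartition (I : Set) : Set where
    field
      partOf     : V → V → I
      partOf-sym : ∀ {u v} → u ~ v → partOf u v ≡ partOf v u

    Part : I → Rel V 0ℓ
    Part i u v = u ~ v × partOf u v ≡ i

  -- Since G has an edge, a layout with no parts at all does not exist,
  -- so the number of parts need not be required to be positive.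
  record QueueLayout (q : ℕ) : Set₁ where
    field
      order     : VertexOrder V
      partition : EdgePartition (Fin q)
    open EdgePartition partition public
    field
      queues    : ∀ i → IsQueue order (Part i)

  record StackQueueLayout (s q : ℕ) : Set₁ where
    field
      order     : VertexOrder V
      partition : EdgePartition (Fin s ⊎ Fin q)
    open EdgePartition partition public
    field
      stacks    : ∀ i → IsStack order (Part (inj₁ i))
      queues    : ∀ j → IsQueue order (Part (inj₂ j))

  record IsQueueNumber (m : ℕ) : Set₁ where
    field
      attained : QueueLayout m
      minimal  : ∀ {q} → QueueLayout q → m ≤ q

  QueueNumberAtMost : ℕ → Set₁
  QueueNumberAtMost k = ∃[ m ] IsQueueNumber m × m ≤ k

  Edgeless : Pred V 0ℓ → Set
  Edgeless S = ∀ {u v} → u ∈ S → v ∈ S → ¬ (u ~ v)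

  record IsBipartition (A B : Pred V 0ℓ) : Set where
    field
      disjoint  : Empty (A ∩ B)
      covers    : Universal (A ∪ B)
      edgelessˡ : Edgeless A
      edgelessʳ : Edgeless B

  Precedes : VertexOrder V → Pred V 0ℓ → Pred V 0ℓ → Set
  Precedes σ A B = ∀ {a b} → a ∈ A → b ∈ B → a < b
    where open VertexOrder σ

  Separated : VertexOrder V → Pred V 0ℓ → Pred V 0ℓ → Set
  Separated σ A B = Precedes σ A B ⊎ Precedes σ B A

  IsSeparatedStackQueueGraph : ℕ → ℕ → Set₁
  IsSeparatedStackQueueGraph s q =
    ∃[ A ] ∃[ B ] IsBipartition A B ×
    (Σ[ L ∈ StackQueueLayout s q ] Separated (StackQueueLayout.order L) A B)

  TransformsBySamePermutation : ∀ {n} → Vector V n → Vector V n → ℕ → Set₁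
  TransformsBySamePermutation {n} u v k =
    Σ[ π ∈ Permutation′ n ] Σ[ L ∈ QueueLayout k ]
      ListsInOrder (QueueLayout.order L) U
        ((u ∘ (π ⟨$⟩ʳ_)) ++ (v ∘ (π ⟨$⟩ʳ_)))

SeparatedBounded : Set₁
SeparatedBounded =
  Σ[ f ∈ (ℕ → ℕ → ℕ) ] ∀ s q → 1 ≤ s → 1 ≤ q →
    ∀ G → IsSeparatedStackQueueGraph G s q → QueueNumberAtMost G (f s q)

-- The condition |A| = |B| is expressed by u and v having the same length n.
SamePermutationBounded : Set₁
SamePermutationBounded =
  Σ[ f ∈ (ℕ → ℕ → ℕ) ] ∀ s q → 1 ≤ s → 1 ≤ q →
    ∀ G A B → IsBipartition G A B →
    ∀ (L : StackQueueLayout G s q) → Separated G (order L) A B →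
    ∀ {n} (u v : Vector (V G) n) →
    ListsInOrder (order L) A u → ListsInOrder (order L) B v →
    TransformsBySamePermutation G u v (f s q)
  where
  open Graph using (V)
  open StackQueueLayout using (order)

OneStackBounded : Set₁
OneStackBounded =
  Σ[ f ∈ (ℕ → ℕ) ] ∀ q → 1 ≤ q →
    ∀ G → IsSeparatedStackQueueGraph G 1 q → QueueNumberAtMost G (f q)

OneStackSixQueueBounded : Set₁
OneStackSixQueueBounded =
  ∃[ C ] ∀ G → IsSeparatedStackQueueGraph G 1 6 → QueueNumberAtMost G C

{-# OPTIONS --safe #-}

-- Two edges in the same queue of a layout, both traversed upwards or both
-- downwards, are monotone: if u < u′ then v ≤ v′.  Monotonicity composes along
-- paths.  Hence if every edge of G is realised by a path of bounded length in an
-- auxiliary graph H, such that paths with equal colour data stay disjoint or merge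
-- for good, then colouring the edges of G by the queues and directions along their
-- paths turns a queue layout of H into one of G.
--
-- For "the same permutation", H is G with the matching u i – v i added, which is one
-- more queue, and the path is u i – v j – u j; the permutation sorts the u i by
-- their position in the layout of H.  Unequal sides are padded with isolated vertices.
--
-- For the reduction to one stack, H is a ladder: every vertex v becomes a rail
-- (v , 0), (v , 1), … whose points alternate between the two sides, and an edge in
-- part number c becomes a rung at level c.  Reversing the order of the right
-- vertices turns stacks into queues, so one reversal, after the levels of
-- the queues, leaves just one stack, and three queues suffice for everything else.
module Submission where

open import Defs
open import Data.Bool.Base using (Bool; true; false; not; _xor_; _∧_; if_then_else_)
import Data.Bool.Properties as Bool
open import Data.Empty using (⊥)
open import Data.Fin.Base as Fin
  using (Fin; zero; suc; toℕ; combine; funToFin; finToFun; opposite; _↑ˡ_; _↑ʳ_; splitAt; inject₁)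
open import Data.Fin.Induction using (<-weakInduction)
open import Data.Fin.Patterns using (0F; 1F; 2F)
open import Data.Fin.Permutation using (Permutation′; _⟨$⟩ʳ_)
import Data.Fin.Properties as Fin
open import Data.Fin.Subset using (Subset; ∣_∣)
import Data.Fin.Subset as Subset
open import Data.Fin.Subset.Properties using (p⊂q⇒∣p∣<∣q∣; ∣⊤∣≡n; ∈⊤)
open import Data.Nat.Base as ℕ using (ℕ; zero; suc; z≤n; s≤s)
import Data.Nat.Properties as ℕ
open import Data.Product using (Σ-syntax; ∃-syntax; _×_; _,_; proj₁; proj₂; swap)
open import Data.Product.Function.NonDependent.Propositional using (_×-↔_)
open import Data.Sum as Sum using (_⊎_; inj₁; inj₂; [_,_]′)
open import Data.Vec.Base using (tabulate)
open import Data.Vec.Functional using (Vector; _++_)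
open import Data.Vec.Properties using (lookup∘tabulate; []=⇒lookup; lookup⇒[]=)
open import Function.Base using (_∘_; _on_; id)
open import Function.Bundles using (_↔_; _⇔_; Injection; Inverse; mk⇔; mk↔ₛ′)
open import Function.Construct.Composition using (_↔-∘_)
open import Function.Construct.Identity using (↔-id)
open import Function.Construct.Symmetry using (↔-sym)
open import Function.Definitions using (Injective)
open import Function.Properties.Inverse using (↔⇒↣)
open import Level using (0ℓ)
open import Relation.Binary.Definitions using (Tri; tri<; tri≈; tri>)
open import Relation.Binary.PropositionalEquality hiding ([_])
open import Relation.Binary.Structures using (IsStrictTotalOrder)
open import Relation.Nullary
open import Relation.Nullary.Decidable using (dec-true; dec-false)
open import Relation.Unary using (Pred)

-- Vertex orders, pullbacks and ranks.

bit : Bool → Fin 2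
bit = Inverse.from Fin.2↔Bool

bit-injective : Injective _≡_ _≡_ bit
bit-injective {false} {false} _ = refl
bit-injective {true}  {true}  _ = refl

bit-<⁻ : ∀ {b c} → bit b Fin.< bit c → b ≡ false × c ≡ true
bit-<⁻ {false} {true}  _        = refl , refl
bit-<⁻ {true}  {true}  (s≤s ())

bit-< : ∀ {b c} → b ≡ false → c ≡ true → bit b Fin.< bit c
bit-< refl refl = s≤s z≤n

module Order {V : Set} (σ : VertexOrder V) where
  open VertexOrder σ public
  open IsStrictTotalOrder isStrictTotalOrder public
    using (compare; _≟_; _<?_; asym; irrefl) renaming (trans to <-trans)

  ascends : V → V → Fin 2
  ascends u v = bit (does (u <? v))

  ascends-cong : ∀ {u v u′ v′} → ascends u v ≡ ascends u′ v′ → u < v → u′ < v′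
  ascends-cong {u} {v} {u′} {v′} eq u<v with u <? v | u′ <? v′
  ... | yes _  | yes u′<v′ = u′<v′
  ascends-cong () _ | yes _ | no _
  ... | no u≮v | _ = contradiction u<v u≮v

↔-injective : {A B : Set} (e : A ↔ B) → Injective _≡_ _≡_ (Inverse.to e)
↔-injective e = Injection.injective (↔⇒↣ e)

pullback : {X V : Set} → VertexOrder V → (f : X → V) → Injective _≡_ _≡_ f → VertexOrder X
pullback σ f f-injective = record
  { _<_ = _<_ on f
  ; isStrictTotalOrder = record
    { isStrictPartialOrder = record
      { isEquivalence = isEquivalence
      ; irrefl        = λ { refl → irrefl refl }
      ; trans         = <-trans
      ; <-resp-≈      = (λ { refl → id }) , (λ { refl → id })
      }
    ; compare = λ x y → compare-on (compare (f x) (f y))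
    }
  }
  where
  open Order σ
  compare-on : ∀ {x y} → Tri (f x < f y) (f x ≡ f y) (f y < f x) →
               Tri (f x < f y) (x ≡ y) (f y < f x)
  compare-on (tri< lt ne gt) = tri< lt (ne ∘ cong f) gt
  compare-on (tri≈ lt eq gt) = tri≈ lt (f-injective eq) gt
  compare-on (tri> lt ne gt) = tri> lt (ne ∘ cong f) gt

orderBy : ∀ {V : Set} {n} (key : V → Fin n) → Injective _≡_ _≡_ key → VertexOrder V
orderBy = pullback record { isStrictTotalOrder = Fin.<-isStrictTotalOrder }

-- Pigeonhole: a missed value could be punched out of the codomain, which would leave an injection
-- of `Fin (suc n)` into `Fin n`.
injective⇒surjective : ∀ {n} {f : Fin n → Fin n} → Injective _≡_ _≡_ f → ∀ j → ∃[ i ] f i ≡ j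
injective⇒surjective {suc n} {f} f-injective j with Fin.any? (λ i → f i Fin.≟ j)
... | yes found = found
... | no missed = contradiction (Fin.injective⇒≤ punched-injective) ℕ.1+n≰n
  where
  avoids : ∀ i → j ≢ f i
  avoids i j≡fi = missed (i , sym j≡fi)
  punched-injective : Injective _≡_ _≡_ (λ i → Fin.punchOut (avoids i))
  punched-injective {i} {i′} = f-injective ∘ Fin.punchOut-injective (avoids i) (avoids i′)

module _ {V : Set} {n : ℕ} (σ : VertexOrder V) (finite : V ↔ Fin n) where
  open Order σ
  open Inverse finite using (to; from; strictlyInverseˡ; strictlyInverseʳ)

  private
    below : V → Subset n
    below x = tabulate (λ i → does (from i <? x))

    ∈-below : ∀ {i x} → from i < x → i Subset.∈ below x
    ∈-below {i} {x} lt = lookup⇒[]= i _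
      (trans (lookup∘tabulate _ i) (dec-true (from i <? x) lt))

    below-∈ : ∀ {i x} → i Subset.∈ below x → from i < x
    below-∈ {i} {x} i∈
      with from i <? x
         | trans (sym (lookup∘tabulate (λ i → does (from i <? x)) i)) ([]=⇒lookup i∈)
    ... | yes lt | _ = lt
    ... | no _   | ()

    ∉-below : ∀ x → ¬ to x Subset.∈ below x
    ∉-below x = irrefl (strictlyInverseʳ x) ∘ below-∈

    ∣below∣<n : ∀ x → ∣ below x ∣ ℕ.< n
    ∣below∣<n x = subst (∣ below x ∣ ℕ.<_) (∣⊤∣≡n n)
      (p⊂q⇒∣p∣<∣q∣ ((λ _ → ∈⊤) , to x , ∈⊤ , ∉-below x))

    rank : V → Fin n
    rank x = Fin.fromℕ< (∣below∣<n x)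

    rank-mono : ∀ {x y} → x < y → rank x Fin.< rank y
    rank-mono {x} {y} x<y = subst₂ ℕ._<_ (sym (Fin.toℕ-fromℕ< _)) (sym (Fin.toℕ-fromℕ< _))
      (p⊂q⇒∣p∣<∣q∣
        ( (λ i∈ → ∈-below (<-trans (below-∈ i∈) x<y))
        , to x , ∈-below (subst (_< y) (sym (strictlyInverseʳ x)) x<y) , ∉-below x))

    rank-injective : Injective _≡_ _≡_ rank
    rank-injective {x} {y} eq with compare x y
    ... | tri< x<y _ _ = contradiction eq (Fin.<⇒≢ (rank-mono x<y))
    ... | tri≈ _ x≡y _ = x≡y
    ... | tri> _ _ y<x = contradiction (sym eq) (Fin.<⇒≢ (rank-mono y<x))

    unrank : ∀ i → ∃[ x ] rank x ≡ i
    unrank i with j , eq ← injective⇒surjective {f = rank ∘ from}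
                   (↔-injective (mk↔ₛ′ from to strictlyInverseʳ strictlyInverseˡ) ∘ rank-injective) i
      = from j , eq

  -- The rank of `x` counts the elements below it. It grows strictly, because `x` lies below every
  -- larger `y` but not below itself, so it is injective and hence bijective onto `Fin n`.
  ranking : Σ[ r ∈ V ↔ Fin n ] (∀ {x y} → x < y → Inverse.to r x Fin.< Inverse.to r y)
  ranking = mk↔ₛ′ rank (proj₁ ∘ unrank) (proj₂ ∘ unrank)
                  (λ x → rank-injective (proj₂ (unrank (rank x))))
          , rank-mono

  rank-cancel : ∀ {x y} → Inverse.to (proj₁ ranking) x Fin.< Inverse.to (proj₁ ranking) y → x < y
  rank-cancel {x} {y} lt with compare x y
  ... | tri< x<y _ _  = x<y
  ... | tri≈ _ refl _ = contradiction lt (ℕ.n≮n _)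
  ... | tri> _ _ y<x  = contradiction lt (ℕ.<-asym (rank-mono y<x))

-- `combine` orders pairs lexicographically; the composite vertex keys of the balanced graph and of
-- the ladder rely on this.
combine-<⁻ : ∀ {m n} (i i′ : Fin m) {j j′ : Fin n} → combine i j Fin.< combine i′ j′ →
             i Fin.< i′ ⊎ (i ≡ i′ × j Fin.< j′)
combine-<⁻ {n = n} i i′ {j} {j′} lt with Fin.<-cmp i i′
... | tri< i<i′ _ _ = inj₁ i<i′
... | tri≈ _ refl _ = inj₂ (refl , ℕ.+-cancelˡ-< (n ℕ.* toℕ i) _ _
                        (subst₂ ℕ._<_ (Fin.toℕ-combine i j) (Fin.toℕ-combine i j′) lt))
... | tri> _ _ i′<i = contradiction lt (ℕ.<-asym (Fin.combine-monoˡ-< j′ j i′<i))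

opposite-anti-< : ∀ {n} {i j : Fin n} → i Fin.< j → opposite j Fin.< opposite i
opposite-anti-< {n} {i} {j} i<j = subst₂ ℕ._<_ (sym (Fin.opposite-prop j)) (sym (Fin.opposite-prop i))
  (ℕ.∸-monoʳ-< (s≤s i<j) (Fin.toℕ<n j))

-- Deciding the existence of queue layouts, and existence of the queue number.

module _ (G : Graph) where
  open Graph G
  open Inverse finite using (to; from; strictlyInverseˡ; strictlyInverseʳ)

  -- A queue layout as finite data: positions in `Fin size` replace the order relation, so that
  -- layouts can be found by exhaustive search.
  IsLayoutCode : ∀ {q} → (V → Fin size) → (V → V → Fin q) → Set
  IsLayoutCode key colour =
    (∀ u v → key u ≡ key v → u ≡ v) ×
    (∀ u v → u ~ v → colour u v ≡ colour v u) ×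
    (∀ u v → u ~ v → ∀ x y → x ~ y → colour u v ≡ colour x y →
      ¬ (key u Fin.< key x × key x Fin.< key y × key y Fin.< key v))

  private
    all-vertices? : ∀ {P : V → Set} → (∀ x → Dec (P x)) → Dec (∀ x → P x)
    all-vertices? {P} P? = map′ (λ p x → subst P (strictlyInverseʳ x) (p (to x))) (λ p i → p (from i))
                             (Fin.all? (P? ∘ from))

    _≟ᵥ_ : (u v : V) → Dec (u ≡ v)
    u ≟ᵥ v = map′ (↔-injective finite) (cong to) (to u Fin.≟ to v)

  isLayoutCode? : ∀ {q} (key : V → Fin size) (colour : V → V → Fin q) → Dec (IsLayoutCode key colour)
  isLayoutCode? key colour =
    all-vertices? (λ u → all-vertices? λ v → (key u Fin.≟ key v) →-dec (u ≟ᵥ v)) ×-dec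
    all-vertices? (λ u → all-vertices? λ v → ~-dec u v →-dec (colour u v Fin.≟ colour v u)) ×-dec
    all-vertices? (λ u → all-vertices? λ v → ~-dec u v →-dec
      all-vertices? (λ x → all-vertices? λ y → ~-dec x y →-dec
        ((colour u v Fin.≟ colour x y) →-dec
         ¬? ((key u Fin.<? key x) ×-dec (key x Fin.<? key y) ×-dec (key y Fin.<? key v)))))

  -- Decoding an encoded function returns it only pointwise, so codes must be transported along
  -- pointwise equality.
  isLayoutCode-resp : ∀ {q} {key key′ : V → Fin size} {colour colour′ : V → V → Fin q} →
    (∀ u → key u ≡ key′ u) → (∀ u v → colour u v ≡ colour′ u v) →
    IsLayoutCode key colour → IsLayoutCode key′ colour′
  isLayoutCode-resp k c (key-injective , colour-sym , no-nesting) =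
    (λ u v eq → key-injective u v (trans (k u) (trans eq (sym (k v))))) ,
    (λ u v e → trans (sym (c u v)) (trans (colour-sym u v e) (c v u))) ,
    (λ u v e x y e′ eq (l₁ , l₂ , l₃) →
      no-nesting u v e x y e′ (trans (c u v) (trans eq (sym (c x y))))
        (back u x l₁ , back x y l₂ , back y v l₃))
    where back = λ u v → subst₂ Fin._<_ (sym (k u)) (sym (k v))

  decode : ∀ {m} → Fin (m ℕ.^ size) → V → Fin m
  decode c = finToFun c ∘ to

  encode : ∀ {m} → (V → Fin m) → Fin (m ℕ.^ size)
  encode f = funToFin (f ∘ from)

  decode-encode : ∀ {m} (f : V → Fin m) x → decode (encode f) x ≡ f x
  decode-encode f x = trans (Fin.finToFun-funToFin (f ∘ from) (to x)) (cong f (strictlyInverseʳ x))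

  queueLayout? : ∀ q → Dec (QueueLayout G q)
  queueLayout? q = map′ fromCode toCode
    -- The binary colouring is coded in two stages: `d` stores, for each `u`, the code of the
    -- colouring with first argument `u`.
    (Fin.any? λ c → Fin.any? λ d → isLayoutCode? (decode c) (λ u v → decode (decode {q ℕ.^ size} d u) v))
    where
    Code : Set
    Code = ∃[ c ] ∃[ d ] IsLayoutCode (decode c) (λ u v → decode {q} (decode d u) v)

    fromCode : Code → QueueLayout G q
    fromCode (_ , _ , key-injective , colour-sym , no-nesting) = record
      { order     = orderBy _ (λ {u} {v} → key-injective u v)
      ; partition = record { partOf = _ ; partOf-sym = λ {u} {v} → colour-sym u v }
      ; queues    = λ i {u} {v} {x} {y} (e , p) (e′ , p′) →
                      no-nesting u v e x y e′ (trans p (sym p′))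
      }

    toCode : QueueLayout G q → Code
    toCode L = encode rank , encode (encode ∘ partOf) ,
      isLayoutCode-resp
        (λ u → sym (decode-encode rank u))
        (λ u v → sym (trans (cong (λ c → decode c v) (decode-encode (encode ∘ partOf) u))
                            (decode-encode (partOf u) v)))
        ( (λ _ _ → ↔-injective (proj₁ (ranking order finite)))
        , (λ _ _ → partOf-sym)
        , λ u v e x y e′ eq (l₁ , l₂ , l₃) → queues _ (e , eq) (e′ , refl)
            (rank-cancel order finite l₁ , rank-cancel order finite l₂ , rank-cancel order finite l₃))
      where
      open QueueLayout L
      rank = Inverse.to (proj₁ (ranking order finite))

least : ∀ {ℓ} {P : ℕ → Set ℓ} → (∀ n → Dec (P n)) → ∀ {k} → P k →
        ∃[ m ] P m × m ℕ.≤ k × (∀ {n} → P n → m ℕ.≤ n)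
least P? {zero}  p = zero , p , z≤n , λ _ → z≤n
least P? {suc k} p with P? zero
... | yes p₀ = zero , p₀ , z≤n , λ _ → z≤n
... | no ¬p₀ with m , pₘ , m≤k , minimal ← least (P? ∘ suc) p =
  suc m , pₘ , s≤s m≤k , λ { {zero} p₀ → contradiction p₀ ¬p₀ ; {suc n} pₙ → s≤s (minimal pₙ) }

-- A bound on the queue number includes an attained minimum; searching upwards from zero with
-- `queueLayout?` finds one no larger than `k`.
queueLayout⇒queueNumber : ∀ {G k} → QueueLayout G k → QueueNumberAtMost G k
queueLayout⇒queueNumber {G} L with m , attained , m≤k , minimal ← least (queueLayout? G) L =
  m , record { attained = attained ; minimal = minimal } , m≤k

-- An optimal layout is padded with empty queues.
queueNumber⇒queueLayout : ∀ {G k} → QueueNumberAtMost G k → QueueLayout G k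
queueNumber⇒queueLayout (m , isQn , m≤k) = record
  { order     = order
  ; partition = record
    { partOf     = λ u v → Fin.inject≤ (partOf u v) m≤k
    ; partOf-sym = λ e → cong (λ i → Fin.inject≤ i m≤k) (partOf-sym e)
    }
  ; queues    = λ _ (e , p) (e′ , p′) →
                  queues _ (e , Fin.inject≤-injective m≤k m≤k _ _ (trans p (sym p′))) (e′ , refl)
  }
  where open QueueLayout (IsQueueNumber.attained isQn)

-- Bipartite layouts with the left side first.

record Sides (G : Graph) : Set where
  open Graph G
  field
    isRight : V → Bool
    flips   : ∀ {u v} → u ~ v → isRight v ≡ not (isRight u)

record SidedStackQueueLayout (G : Graph) (s q : ℕ) : Set₁ where
  field
    sides  : Sides G
    layout : StackQueueLayout G s q
  open Sides sides public
  open StackQueueLayout layout public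
  open Order order public
  field
    left<right : ∀ {a b} → isRight a ≡ false → isRight b ≡ true → a < b

module _ {G : Graph} where
  open Graph G

  swap-bipartition : ∀ {A B} → IsBipartition G A B → IsBipartition G B A
  swap-bipartition bip = record
    { disjoint  = λ x (b , a) → disjoint x (a , b)
    ; covers    = λ x → Sum.swap (covers x)
    ; edgelessˡ = edgelessʳ
    ; edgelessʳ = edgelessˡ
    }
    where open IsBipartition bip

  fromBipartition : ∀ {A B} → IsBipartition G A B →
    Σ[ S ∈ Sides G ] (∀ {x} → Sides.isRight S x ≡ false → A x) × (∀ {x} → Sides.isRight S x ≡ true → B x)
  fromBipartition {A} {B} bip = record { isRight = isRight ; flips = λ {u} {v} → flips u v } ,
    (λ {x} → inA x) , (λ {x} → inB x)
    where
    open IsBipartition bip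
    isRight : V → Bool
    isRight x = Sum.[ (λ _ → false) , (λ _ → true) ] (covers x)

    inA : ∀ x → isRight x ≡ false → A x
    inA x _ with covers x
    inA x _  | inj₁ a = a
    inA x () | inj₂ b

    inB : ∀ x → isRight x ≡ true → B x
    inB x _ with covers x
    inB x () | inj₁ a
    inB x _  | inj₂ b = b

    flips : ∀ u v → u ~ v → isRight v ≡ not (isRight u)
    flips u v e with covers u | covers v
    ... | inj₁ a | inj₁ a′ = contradiction e (edgelessˡ a a′)
    ... | inj₁ _ | inj₂ _  = refl
    ... | inj₂ _ | inj₁ _  = refl
    ... | inj₂ b | inj₂ b′ = contradiction e (edgelessʳ b b′)

  sided : ∀ {s q} → IsSeparatedStackQueueGraph G s q → SidedStackQueueLayout G s q
  sided (A , B , bip , L , separated) = choose separated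
    where
    from-precedes : ∀ {A B} → IsBipartition G A B → Precedes G (StackQueueLayout.order L) A B →
                    SidedStackQueueLayout G _ _
    from-precedes bip A<B with S , inA , inB ← fromBipartition bip = record
      { sides = S ; layout = L ; left<right = λ a b → A<B (inA a) (inB b) }

    choose : Separated G (StackQueueLayout.order L) A B → SidedStackQueueLayout G _ _
    choose (inj₁ A<B) = from-precedes bip A<B
    choose (inj₂ B<A) = from-precedes (swap-bipartition bip) B<A

  sides-bipartition : (S : Sides G) →
    IsBipartition G (λ x → Sides.isRight S x ≡ false) (λ x → Sides.isRight S x ≡ true)
  sides-bipartition S = record
    { disjoint  = λ _ (a , b) → contradiction (trans (sym a) b) λ ()
    ; covers    = covers
    ; edgelessˡ = λ a a′ e → contradiction (trans (sym a′) (trans (flips e) (cong not a))) λ ()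
    ; edgelessʳ = λ b b′ e → contradiction (trans (sym b′) (trans (flips e) (cong not b))) λ ()
    }
    where
    open Sides S
    covers : ∀ x → isRight x ≡ false ⊎ isRight x ≡ true
    covers x with isRight x
    ... | false = inj₁ refl
    ... | true  = inj₂ refl

  unsided : ∀ {s q} → SidedStackQueueLayout G s q → IsSeparatedStackQueueGraph G s q
  unsided L = _ , _ , sides-bipartition sides , layout , inj₁ left<right
    where open SidedStackQueueLayout L

  module _ (S : Sides G) (σ : VertexOrder V) where
    open Sides S
    open Order σ

    -- Evaluating `κ` from the left end to the right end makes the part of an edge independent of
    -- the naming of its ends, even if `κ` is not symmetric.
    leftFirst : ∀ {I : Set} → (V → V → I) → EdgePartition G I
    leftFirst κ = record { partOf = partOf ; partOf-sym = λ {u} {v} → partOf-sym u v }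
      where
      partOf : V → V → _
      partOf u v = if isRight u then κ v u else κ u v

      partOf-sym : ∀ u v → u ~ v → partOf u v ≡ partOf v u
      partOf-sym u v e with isRight u | isRight v | flips e
      ... | false | true  | _ = refl
      ... | true  | false | _ = refl

    leftFirst-left : ∀ {I : Set} (κ : V → V → I) {u v} → isRight u ≡ false →
                     EdgePartition.partOf (leftFirst κ) u v ≡ κ u v
    leftFirst-left κ {u} {v} left = cong (if_then κ v u else κ u v) left

    -- When the left side comes first, the smaller end of every edge is its left end. Two edges with
    -- left ends `a < a′` can then cross only if `b < b′` and nest only if `b′ < b`.
    sidedLayout : ∀ {s q}
      (left<right : ∀ {a b} → isRight a ≡ false → isRight b ≡ true → a < b)
      (κ : V → V → Fin s ⊎ Fin q)
      (stacks : ∀ {a b a′ b′ i} → isRight a ≡ false → isRight a′ ≡ false → a ~ b → a′ ~ b′ →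
                κ a b ≡ inj₁ i → κ a′ b′ ≡ inj₁ i → a < a′ → ¬ b < b′)
      (queues : ∀ {a b a′ b′ j} → isRight a ≡ false → isRight a′ ≡ false → a ~ b → a′ ~ b′ →
                κ a b ≡ inj₂ j → κ a′ b′ ≡ inj₂ j → a < a′ → ¬ b′ < b) →
      SidedStackQueueLayout G s q
    sidedLayout left<right κ stacks queues = record
      { sides      = S
      ; layout     = record
        { order     = σ
        ; partition = leftFirst κ
        ; stacks    = λ i {u} {v} {x} {y} (e , p) (e′ , p′) (u<x , x<v , v<y) →
            let l = left-end e (<-trans u<x x<v) ; l′ = left-end e′ (<-trans x<v v<y) in
            stacks l l′ e e′
              (trans (sym (leftFirst-left κ l)) p) (trans (sym (leftFirst-left κ l′)) p′) u<x v<y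
        ; queues    = λ j {u} {v} {x} {y} (e , p) (e′ , p′) (u<x , x<y , y<v) →
            let l = left-end e (<-trans u<x (<-trans x<y y<v)) ; l′ = left-end e′ x<y in
            queues l l′ e e′
              (trans (sym (leftFirst-left κ l)) p) (trans (sym (leftFirst-left κ l′)) p′) u<x y<v
        }
      ; left<right = left<right
      }
      where
      left-end : ∀ {u v} → u ~ v → u < v → isRight u ≡ false
      left-end {u} e u<v with isRight u in eq
      ... | false = refl
      ... | true  = contradiction u<v (asym (left<right (trans (flips e) (cong not eq)) eq))

    -- Here `σ` may interleave the two sides. The extra bit `ascends` separates edges that run
    -- upwards from their left end from those that run downwards. Nested edges of equal direction
    -- violate `mono`, directly if they ascend and with the roles of the two edges exchanged if they
    -- descend.
    monotoneLayout : ∀ {m} (κ : V → V → Fin m) →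
      (∀ {a b a′ b′} → isRight a ≡ false → isRight a′ ≡ false → a ~ b → a′ ~ b′ →
        κ a b ≡ κ a′ b′ → a < a′ → ¬ b′ < b) →
      QueueLayout G (m ℕ.* 2)
    monotoneLayout κ mono = record
      { order     = σ
      ; partition = partition
      ; queues    = λ _ (e , p) (e′ , p′) → no-nesting e e′ (trans p (sym p′))
      }
      where
      partition : EdgePartition G _
      partition = leftFirst (λ a b → combine (κ a b) (ascends a b))
      open EdgePartition partition

      no-nesting : ∀ {u v x y} → u ~ v → x ~ y → partOf u v ≡ partOf x y → ¬ Nests σ (u , v) (x , y)
      no-nesting {u} {v} {x} {y} e e′ eq (u<x , x<y , y<v)
        with isRight u in u-side | isRight x in x-side
      ... | false | false = mono u-side x-side e e′ (Fin.combine-injectiveˡ _ _ _ _ eq) u<x y<v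
      ... | true  | true  = mono (trans (flips e′) (cong not x-side)) (trans (flips e) (cong not u-side))
                              (~-sym e′) (~-sym e) (Fin.combine-injectiveˡ _ _ _ _ (sym eq)) y<v u<x
      ... | false | true  = asym x<y (ascends-cong (Fin.combine-injectiveʳ (κ u v) _ (κ y x) _ eq)
                              (<-trans u<x (<-trans x<y y<v)))
      ... | true  | false = asym (<-trans u<x (<-trans x<y y<v))
                              (ascends-cong (Fin.combine-injectiveʳ (κ x y) _ (κ v u) _ (sym eq)) x<y)

-- Monotonicity of edges with the same queue and direction.

module _ {G : Graph} {k : ℕ} (L : QueueLayout G k) where
  open Graph G
  open QueueLayout L
  open Order order

  edgeInfo : V → V → Fin (k ℕ.* 2)
  edgeInfo u v = combine (partOf u v) (ascends u v)

  -- A violation would be a nesting: `u < u′ < v′ < v` if both edges ascend, and `v′ < v < u < u′`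
  -- if both descend.
  edgeInfo-mono : ∀ {u v u′ v′} → u ~ v → u′ ~ v′ → edgeInfo u v ≡ edgeInfo u′ v′ → u < u′ → ¬ v′ < v
  edgeInfo-mono {u} {v} {u′} {v′} e e′ eq u<u′ v′<v
    with part-eq , dir-eq ← Fin.combine-injective (partOf u v) _ (partOf u′ v′) _ eq
    with u <? v | u′ <? v′ | bit-injective dir-eq
  ... | yes _  | yes u′<v′ | _ = queues _ (e , part-eq) (e′ , refl) (u<u′ , u′<v′ , v′<v)
  ... | no u≮v | no u′≮v′  | _ = queues _
      (~-sym e′ , trans (partOf-sym (~-sym e′)) (sym part-eq)) (~-sym e , partOf-sym (~-sym e))
      (v′<v , v<u , u<u′)
    where
    v<u : v < u
    v<u with compare u v
    ... | tri< u<v _ _ = contradiction u<v u≮v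
    ... | tri≈ _ u≡v _ = contradiction e (~-irrefl u≡v)
    ... | tri> _ _ v<u = v<u

-- Balancing the sides: from a common permutation to bounded queue number.

×-finite : ∀ {A B : Set} {m n} → A ↔ Fin m → B ↔ Fin n → (A × B) ↔ Fin (m ℕ.* n)
×-finite A↔ B↔ = ↔-sym Fin.*↔× ↔-∘ (A↔ ×-↔ B↔)

restrictLayout : ∀ {G H k} (f : Graph.V G → Graph.V H) → Injective _≡_ _≡_ f →
  (∀ {u v} → Graph._~_ G u v → Graph._~_ H (f u) (f v)) → QueueLayout H k → QueueLayout G k
restrictLayout f f-injective f-hom L = record
  { order     = pullback order f f-injective
  ; partition = record
    { partOf     = λ u v → partOf (f u) (f v)
    ; partOf-sym = partOf-sym ∘ f-hom
    }
  ; queues    = λ i (e , p) (e′ , p′) → queues i (f-hom e , p) (f-hom e′ , p′)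
  }
  where open QueueLayout L

module Balance {G : Graph} {s q : ℕ} (L : SidedStackQueueLayout G s q) where
  open Graph G
  open SidedStackQueueLayout L

  -- Each side becomes a copy of V, so that both have |V| elements; a vertex of
  -- G lives on its own side and its other copy is isolated.
  balanced : Graph
  balanced = record
    { V        = V × Bool
    ; size     = size ℕ.* 2
    ; finite   = ×-finite finite (↔-sym Fin.2↔Bool)
    ; _~_      = λ (u , b) (v , c) → u ~ v × b ≡ isRight u × c ≡ isRight v
    ; ~-dec    = λ (u , b) (v , c) → ~-dec u v ×-dec (b Bool.≟ isRight u) ×-dec (c Bool.≟ isRight v)
    ; ~-sym    = λ (e , p , q) → ~-sym e , q , p
    ; ~-irrefl = λ { refl (e , _) → ~-irrefl refl e }
    ; has-edge = let u , v , e = has-edge in (u , isRight u) , (v , isRight v) , e , refl , refl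
    }

  balancedSides : Sides balanced
  balancedSides = record
    { isRight = proj₂
    ; flips   = λ (e , b≡ , c≡) → trans c≡ (trans (flips e) (cong not (sym b≡)))
    }

  private
    r : V ↔ Fin size
    r = proj₁ (ranking order finite)
    open Inverse r using (to; from; strictlyInverseˡ; strictlyInverseʳ)

    key : V × Bool → Fin (2 ℕ.* size)
    key (v , b) = combine (bit b) (to v)

    key-injective : Injective _≡_ _≡_ key
    key-injective {_ , b} {_ , c} eq with p , q ← Fin.combine-injective (bit b) _ (bit c) _ eq =
      cong₂ _,_ (↔-injective r q) (bit-injective p)

    -- Only copies on their own side carry edges. For these the new order agrees with the old one,
    -- across the sides by `left<right` and within a side by rank.
    key-cancel : ∀ {u v b c} → b ≡ isRight u → c ≡ isRight v → key (u , b) Fin.< key (v , c) → u < v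
    key-cancel {b = b} {c} b≡ c≡ lt with combine-<⁻ (bit b) (bit c) lt
    ... | inj₁ b<c with b-left , c-right ← bit-<⁻ b<c = left<right (trans (sym b≡) b-left) (trans (sym c≡) c-right)
    ... | inj₂ (_ , u<v) = rank-cancel order finite u<v

  balancedLayout : StackQueueLayout balanced s q
  balancedLayout = record
    { order     = orderBy key key-injective
    ; partition = record { partOf = λ (u , _) (v , _) → partOf u v ; partOf-sym = partOf-sym ∘ proj₁ }
    ; stacks    = λ i ((e , b , c) , p) ((e′ , b′ , c′) , p′) (l₁ , l₂ , l₃) →
                    stacks i (e , p) (e′ , p′) (key-cancel b b′ l₁ , key-cancel b′ c l₂ , key-cancel c c′ l₃)
    ; queues    = λ i ((e , b , c) , p) ((e′ , b′ , c′) , p′) (l₁ , l₂ , l₃) →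
                    queues i (e , p) (e′ , p′) (key-cancel b b′ l₁ , key-cancel b′ c′ l₂ , key-cancel c′ c l₃)
    }

  copy-inOrder : ∀ b → ListsInOrder (orderBy key key-injective) (λ x → proj₂ x ≡ b) (λ i → from i , b)
  copy-inOrder b = record
    { increasing = λ {i} {j} i<j → subst₂ Fin._<_
        (cong (combine (bit b)) (sym (strictlyInverseˡ i))) (cong (combine (bit b)) (sym (strictlyInverseˡ j)))
        (combine-monoʳ-< (bit b) i<j)
    ; sound      = λ _ → refl
    ; complete   = λ { {v , _} refl → to v , cong (_, b) (strictlyInverseʳ v) }
    }
    where
    combine-monoʳ-< : ∀ {m n} (k : Fin m) {i j : Fin n} → i Fin.< j → combine k i Fin.< combine k j
    combine-monoʳ-< {n = n} k {i} {j} i<j =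
      subst₂ ℕ._<_ (sym (Fin.toℕ-combine k i)) (sym (Fin.toℕ-combine k j)) (ℕ.+-monoʳ-< (n ℕ.* toℕ k) i<j)

  balanced-separated :
    Separated balanced (orderBy key key-injective) (λ x → proj₂ x ≡ false) (λ x → proj₂ x ≡ true)
  balanced-separated = inj₁ λ {(u , _)} {(v , _)} b c → Fin.combine-monoˡ-< (to u) (to v) (bit-< b c)

samePermutation⇒separated : SamePermutationBounded → SeparatedBounded
samePermutation⇒separated (f , bounded) = f , λ s q 1≤s 1≤q G sep →
  let L             = sided sep
      open SidedStackQueueLayout L using (isRight)
      open Balance L
      _ , L′ , _ = bounded s q 1≤s 1≤q balanced _ _ (sides-bipartition balancedSides)
                        balancedLayout balanced-separated _ _ (copy-inOrder false) (copy-inOrder true)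
  -- The copies that lie on their own side induce `G`.
  in queueLayout⇒queueNumber
       (restrictLayout (λ v → v , isRight v) (cong proj₁) (λ e → e , refl , refl) L′)

-- Adding the matching: from bounded queue number to a common permutation.

module Match (G : Graph) {A B : Pred (Graph.V G) 0ℓ} (bip : IsBipartition G A B) {s q : ℕ}
  (L : StackQueueLayout G s q) (separated : Separated G (StackQueueLayout.order L) A B)
  {n : ℕ} (u v : Vector (Graph.V G) n)
  (u-lists : ListsInOrder (StackQueueLayout.order L) A u)
  (v-lists : ListsInOrder (StackQueueLayout.order L) B v) where
  open Graph G
  open IsBipartition bip
  open StackQueueLayout L
  open Order order
  module u = ListsInOrder u-lists
  module v = ListsInOrder v-lists

  Matched : V → V → Set
  Matched x y = ∃[ i ] u i ≡ x × v i ≡ y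

  matched? : ∀ x y → Dec (Matched x y)
  matched? x y = Fin.any? λ i → (u i ≟ x) ×-dec (v i ≟ y)

  matched-edge : ∀ {x y} → Matched x y → A x × B y
  matched-edge (i , refl , refl) = u.sound i , v.sound i

  matchedGraph : Graph
  matchedGraph = record
    { V        = V
    ; size     = size
    ; finite   = finite
    ; _~_      = λ x y → x ~ y ⊎ Matched x y ⊎ Matched y x
    ; ~-dec    = λ x y → ~-dec x y ⊎-dec matched? x y ⊎-dec matched? y x
    ; ~-sym    = [ inj₁ ∘ ~-sym , inj₂ ∘ Sum.swap ]′
    ; ~-irrefl = λ { refl (inj₁ e) → ~-irrefl refl e
                   ; refl (inj₂ (inj₁ m)) → disjoint _ (matched-edge m)
                   ; refl (inj₂ (inj₂ m)) → disjoint _ (matched-edge m) }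
    ; has-edge = let x , y , e = has-edge in x , y , inj₁ e
    }

  matchedBipartition : IsBipartition matchedGraph A B
  matchedBipartition = record
    { disjoint  = disjoint
    ; covers    = covers
    ; edgelessˡ = λ { a a′ (inj₁ e) → edgelessˡ a a′ e
                    ; a a′ (inj₂ (inj₁ m)) → disjoint _ (a′ , proj₂ (matched-edge m))
                    ; a a′ (inj₂ (inj₂ m)) → disjoint _ (a , proj₂ (matched-edge m)) }
    ; edgelessʳ = λ { b b′ (inj₁ e) → edgelessʳ b b′ e
                    ; b b′ (inj₂ (inj₁ m)) → disjoint _ (proj₁ (matched-edge m) , b)
                    ; b b′ (inj₂ (inj₂ m)) → disjoint _ (proj₁ (matched-edge m) , b′) }
    }

  private module Increasing {w : Vector V n} (w-increasing : ∀ {i j} → i Fin.< j → w i < w j) where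
    cancel : ∀ {i j} → w i < w j → i Fin.< j
    cancel {i} {j} lt with Fin.<-cmp i j
    ... | tri< i<j _ _  = i<j
    ... | tri≈ _ refl _ = contradiction lt (irrefl refl)
    ... | tri> _ _ j<i  = contradiction lt (asym (w-increasing j<i))

    injective : Injective _≡_ _≡_ w
    injective {i} {j} eq with Fin.<-cmp i j
    ... | tri< i<j _ _ = contradiction (w-increasing i<j) (irrefl eq)
    ... | tri≈ _ i≡j _ = i≡j
    ... | tri> _ _ j<i = contradiction (w-increasing j<i) (irrefl (sym eq))

  open Increasing {u} u.increasing renaming (cancel to u-cancel; injective to u-injective)
  open Increasing {v} v.increasing renaming (cancel to v-cancel; injective to v-injective)

  same-direction : ∀ {i j} → u i < v i → ¬ v j < u j
  same-direction {i} {j} u<v v<u = [ (λ A<B → asym v<u (A<B (u.sound j) (v.sound j)))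
                                   , (λ B<A → asym u<v (B<A (v.sound i) (u.sound i))) ]′ separated

  -- Both lists increase, so a nesting of two matching edges with equal direction would give `i < j`
  -- and `j < i`. Opposite directions are excluded by separation.
  matching-queue : IsQueue order (λ x y → Matched x y ⊎ Matched y x)
  matching-queue (inj₁ (i , refl , refl)) (inj₁ (j , refl , refl)) (l₁ , l₂ , l₃) =
    ℕ.<-asym (u-cancel l₁) (v-cancel l₃)
  matching-queue (inj₂ (i , refl , refl)) (inj₂ (j , refl , refl)) (l₁ , l₂ , l₃) =
    ℕ.<-asym (v-cancel l₁) (u-cancel l₃)
  matching-queue (inj₁ (i , refl , refl)) (inj₂ (j , refl , refl)) (l₁ , l₂ , l₃) =
    same-direction (<-trans l₁ (<-trans l₂ l₃)) l₂
  matching-queue (inj₂ (i , refl , refl)) (inj₁ (j , refl , refl)) (l₁ , l₂ , l₃) =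
    same-direction l₂ (<-trans l₁ (<-trans l₂ l₃))

  -- Queue `zero` is the new one and the old queues are shifted. A matching edge that is already an
  -- edge of `G` keeps its old part, so only matching edges land in queue `zero`.
  matchedPart : ∀ {x y} → Dec (x ~ y) → Fin s ⊎ Fin q → Fin s ⊎ Fin (suc q)
  matchedPart (yes _) p = Sum.map₂ suc p
  matchedPart (no _)  p = inj₂ zero

  matchedPart-stack : ∀ {x y p i} (e? : Dec (x ~ y)) → matchedPart e? p ≡ inj₁ i → x ~ y × p ≡ inj₁ i
  matchedPart-stack {p = inj₁ _} (yes e) refl = e , refl

  matchedPart-queue : ∀ {x y p j} (e? : Dec (x ~ y)) → matchedPart e? p ≡ inj₂ (suc j) → x ~ y × p ≡ inj₂ j
  matchedPart-queue {p = inj₂ _} (yes e) refl = e , refl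

  matchedPart-new : ∀ {x y p} (e? : Dec (x ~ y)) → matchedPart e? p ≡ inj₂ zero → ¬ x ~ y
  matchedPart-new {p = inj₁ _} (yes _) ()
  matchedPart-new {p = inj₂ _} (yes _) ()
  matchedPart-new (no ¬e) _ = ¬e

  matchedLayout : StackQueueLayout matchedGraph s (suc q)
  matchedLayout = record
    { order     = order
    ; partition = record
      { partOf     = λ x y → matchedPart (~-dec x y) (partOf x y)
      ; partOf-sym = λ {x} {y} _ → part-sym x y
      }
    ; stacks    = λ i (_ , p) (_ , p′) →
                    stacks i (matchedPart-stack (~-dec _ _) p) (matchedPart-stack (~-dec _ _) p′)
    ; queues    = λ { zero (e , p) (e′ , p′) → matching-queue (isNew e p) (isNew e′ p′)
                    ; (suc j) (_ , p) (_ , p′) →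
                      queues j (matchedPart-queue (~-dec _ _) p) (matchedPart-queue (~-dec _ _) p′) }
    }
    where
    part-sym : ∀ x y → matchedPart (~-dec x y) (partOf x y) ≡ matchedPart (~-dec y x) (partOf y x)
    part-sym x y with ~-dec x y | ~-dec y x
    ... | yes e | yes _ = cong (Sum.map₂ suc) (partOf-sym e)
    ... | yes e | no ¬e = contradiction (~-sym e) ¬e
    ... | no ¬e | yes e = contradiction (~-sym e) ¬e
    ... | no _  | no _  = refl

    isNew : ∀ {x y M} → x ~ y ⊎ M → matchedPart (~-dec x y) (partOf x y) ≡ inj₂ zero → M
    isNew (inj₁ e) p = contradiction e (matchedPart-new (~-dec _ _) p)
    isNew (inj₂ m) _ = m

  module _ {k : ℕ} (M : QueueLayout matchedGraph k) where
    private
      module M = QueueLayout M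
      module τ = Order M.order

      indexOrder : VertexOrder (Fin n)
      indexOrder = pullback M.order u u-injective

      r : Fin n ↔ Fin n
      r = proj₁ (ranking indexOrder (↔-id (Fin n)))

      -- `rank` sends an index to its position, whereas `π` must send a position to the index placed
      -- there.
      π : Permutation′ n
      π = ↔-sym r

      rank : Fin n → Fin n
      rank = Inverse.to r

      rank-cancel-u : ∀ {i j} → rank i Fin.< rank j → u i τ.< u j
      rank-cancel-u = rank-cancel indexOrder (↔-id (Fin n))

      w : Vector V (n ℕ.+ n)
      w = (u ∘ (π ⟨$⟩ʳ_)) ++ (v ∘ (π ⟨$⟩ʳ_))

      data Located : V → Set where
        left  : ∀ i → Located (u i)
        right : ∀ i → Located (v i)

      locate : ∀ x → Located x
      locate x with covers x
      ... | inj₁ a with i , refl ← u.complete a = left i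
      ... | inj₂ b with i , refl ← v.complete b = right i

      index : ∀ {x} → Located x → Fin n
      index (left i)  = i
      index (right i) = i

      position : ∀ {x} → Located x → Fin (n ℕ.+ n)
      position (left i)  = rank i ↑ˡ n
      position (right i) = n ↑ʳ rank i

      w-position : ∀ {x} (ℓ : Located x) → w (position ℓ) ≡ x
      w-position (left i)  = trans (cong [ _ , _ ]′ (Fin.splitAt-↑ˡ n (rank i) n)) (cong u (Inverse.strictlyInverseʳ r i))
      w-position (right i) = trans (cong [ _ , _ ]′ (Fin.splitAt-↑ʳ n n (rank i))) (cong v (Inverse.strictlyInverseʳ r i))

      pos : V → Fin (n ℕ.+ n)
      pos x = position (locate x)

      w-pos : ∀ x → w (pos x) ≡ x
      w-pos x = w-position (locate x)

      pos-injective : Injective _≡_ _≡_ pos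
      pos-injective {x} {y} eq = trans (sym (w-pos x)) (trans (cong w eq) (w-pos y))

      u≢v : ∀ {i j} → u i ≢ v j
      u≢v {i} {j} eq = disjoint (u i) (u.sound i , subst B (sym eq) (v.sound j))

      position-left : ∀ {x i} (ℓ : Located x) → u i ≡ x → position ℓ ≡ rank i ↑ˡ n
      position-left (left j)  eq = cong (λ i → rank i ↑ˡ n) (sym (u-injective eq))
      position-left (right j) eq = contradiction eq u≢v

      locate-right : ∀ {x i} (ℓ : Located x) → v i ≡ x → position ℓ ≡ n ↑ʳ rank i × index ℓ ≡ i
      locate-right (left j)  eq = contradiction (sym eq) u≢v
      locate-right (right j) eq with refl ← v-injective eq = refl , refl

      pos-u : ∀ i → pos (u i) ≡ rank i ↑ˡ n
      pos-u i = position-left (locate (u i)) refl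

      pos-v : ∀ i → pos (v i) ≡ n ↑ʳ rank i
      pos-v i = proj₁ (locate-right (locate (v i)) refl)

      pos-w : ∀ p → pos (w p) ≡ p
      pos-w p with splitAt n p in eq
      ... | inj₁ i = trans (pos-u _) (trans (cong (_↑ˡ n) (Inverse.strictlyInverseˡ r i)) (Fin.splitAt⁻¹-↑ˡ eq))
      ... | inj₂ i = trans (pos-v _) (trans (cong (n ↑ʳ_) (Inverse.strictlyInverseˡ r i)) (Fin.splitAt⁻¹-↑ʳ eq))

      pos-u-cancel : ∀ {i j} → pos (u i) Fin.< pos (u j) → u i τ.< u j
      pos-u-cancel {i} {j} lt = rank-cancel-u
        (subst₂ ℕ._<_ (trans (cong toℕ (pos-u i)) (Fin.toℕ-↑ˡ (rank i) n))
                      (trans (cong toℕ (pos-u j)) (Fin.toℕ-↑ˡ (rank j) n)) lt)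

      -- The right vertices are placed in the order of their left partners, so positions on the
      -- right also reflect the order of the `u i` in `M`. This is why paths are extended to end at
      -- `u j`.
      pos-v-cancel : ∀ {i j} → pos (v i) Fin.< pos (v j) → u i τ.< u j
      pos-v-cancel {i} {j} lt = rank-cancel-u (ℕ.+-cancelˡ-< n _ _
        (subst₂ ℕ._<_ (trans (cong toℕ (pos-v i)) (Fin.toℕ-↑ʳ n (rank i)))
                      (trans (cong toℕ (pos-v j)) (Fin.toℕ-↑ʳ n (rank j))) lt))

      mate : V → V
      mate x = u (index (locate x))

      mate-v : ∀ i → mate (v i) ≡ u i
      mate-v i = cong u (proj₂ (locate-right (locate (v i)) refl))

      colour : V → V → Fin (k ℕ.* 2 ℕ.* (k ℕ.* 2))
      colour a b = combine (edgeInfo M a b) (edgeInfo M b (mate b))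

      -- The edge u i – v j extends to the path u i – v j – u j of the matched
      -- graph, and two paths of the same colour are monotone in M.
      colour-mono : ∀ {i j i′ j′} → u i ~ v j → u i′ ~ v j′ → colour (u i) (v j) ≡ colour (u i′) (v j′) →
                    u i τ.< u i′ → ¬ u j′ τ.< u j
      colour-mono {i} {j} {i′} {j′} e e′ eq u<u′ lt
        with eq₁ , eq₂ ← Fin.combine-injective (edgeInfo M (u i) (v j)) _ (edgeInfo M (u i′) (v j′)) _ eq
        with τ.compare (v j) (v j′)
      ... | tri< v<v′ _ _ = edgeInfo-mono M (inj₂ (inj₂ (j , refl , refl))) (inj₂ (inj₂ (j′ , refl , refl)))
                              (subst₂ (λ x y → edgeInfo M (v j) x ≡ edgeInfo M (v j′) y) (mate-v j) (mate-v j′) eq₂)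
                              v<v′ lt
      ... | tri≈ _ v≡v′ _ = τ.irrefl (cong u (sym (v-injective v≡v′))) lt
      ... | tri> _ _ v′<v = edgeInfo-mono M (inj₁ e) (inj₁ e′) eq₁ u<u′ v′<v

    -- Each of the two edges of a path contributes a factor `k * 2`; the last factor 2 is the
    -- direction bit of `monotoneLayout`.
    transformed : TransformsBySamePermutation G u v (k ℕ.* 2 ℕ.* (k ℕ.* 2) ℕ.* 2)
    transformed = π , monotoneLayout (proj₁ (fromBipartition bip)) (orderBy pos pos-injective) colour mono , record
      { increasing = λ {p} {p′} → subst₂ Fin._<_ (sym (pos-w p)) (sym (pos-w p′))
      ; sound      = λ _ → _
      ; complete   = λ {x} _ → pos x , w-pos x
      }
      where
      open Sides (proj₁ (fromBipartition bip))
      inA = proj₁ (proj₂ (fromBipartition bip))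
      inB = proj₂ (proj₂ (fromBipartition bip))

      mono : ∀ {a b a′ b′} → isRight a ≡ false → isRight a′ ≡ false → a ~ b → a′ ~ b′ →
             colour a b ≡ colour a′ b′ → pos a Fin.< pos a′ → ¬ pos b′ Fin.< pos b
      mono a-left a′-left e e′ eq lt lt′
        with u.complete (inA a-left) | u.complete (inA a′-left)
           | v.complete (inB (trans (flips e) (cong not a-left)))
           | v.complete (inB (trans (flips e′) (cong not a′-left)))
      ... | i , refl | i′ , refl | j , refl | j′ , refl =
        colour-mono e e′ eq (pos-u-cancel lt) (pos-v-cancel lt′)

separated⇒samePermutation : SeparatedBounded → SamePermutationBounded
separated⇒samePermutation (f , bounded) = 
  (λ s q → let k = f s (suc q) in k ℕ.* 2 ℕ.* (k ℕ.* 2) ℕ.* 2) ,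
  λ s q 1≤s 1≤q G A B bip L separated u v u-lists v-lists →
  let open Match G bip L separated u v u-lists v-lists
  in transformed (queueNumber⇒queueLayout
       (bounded s (suc q) 1≤s (s≤s z≤n) matchedGraph (A , B , matchedBipartition , matchedLayout , separated)))

-- The ladder: reduction to one stack and six queues.

odd : ℕ → Bool
odd zero    = false
odd (suc n) = not (odd n)

xor-cancelʳ : ∀ z {x y} → x xor z ≡ y xor z → x ≡ y
xor-cancelʳ _     {false} {false} _ = refl
xor-cancelʳ _     {true}  {true}  _ = refl
xor-cancelʳ false {false} {true}  ()
xor-cancelʳ true  {false} {true}  ()
xor-cancelʳ false {true}  {false} ()
xor-cancelʳ true  {true}  {false} ()

orient : ∀ {n} → Bool → Fin n → Fin n
orient reversed r = if reversed then opposite r else r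

orient-injective : ∀ {n} b {r r′ : Fin n} → orient b r ≡ orient b r′ → r ≡ r′
orient-injective false eq = eq
orient-injective true {r} {r′} eq =
  trans (sym (Fin.opposite-involutive r)) (trans (cong opposite eq) (Fin.opposite-involutive r′))

opposite-cancel-< : ∀ {n} {i j : Fin n} → opposite i Fin.< opposite j → j Fin.< i
opposite-cancel-< lt =
  subst₂ Fin._<_ (Fin.opposite-involutive _) (Fin.opposite-involutive _) (opposite-anti-< lt)

orient-anti-< : ∀ {n} {b c} → b ≢ c → {r r′ : Fin n} →
  orient b r Fin.< orient b r′ → orient c r′ Fin.< orient c r
orient-anti-< {b = false} {false} b≢c = contradiction refl b≢c
orient-anti-< {b = false} {true}  _   = opposite-anti-<
orient-anti-< {b = true}  {false} _   = opposite-cancel-<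
orient-anti-< {b = true}  {true}  b≢c = contradiction refl b≢c

-- For rails with `n` edges, the factors count the level of the rung, the queue and direction of the
-- rung, the same data along both rails, and the direction bit of `monotoneLayout`.
ladderBound : ℕ → ℕ → ℕ
ladderBound k n = suc n ℕ.* (k ℕ.* 2 ℕ.* ((k ℕ.* 2) ℕ.^ n ℕ.* (k ℕ.* 2) ℕ.^ n)) ℕ.* 2

-- The rails (v , 0), (v , 1), … of all vertices v are joined by one rung per edge
-- of G, at the level of its part; queues occupy the levels up to q, stacks those
-- above.  Beyond level q the right vertices appear in reverse order, which makes
-- the rungs of every stack non-nesting; the rail edges where the reversal happens
-- are the only stack.
module Ladder {G : Graph} {s q : ℕ} (L : SidedStackQueueLayout G s (suc q)) where
  open Graph G
  open SidedStackQueueLayout L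

  levels : ℕ
  levels = suc q ℕ.+ s

  level : Fin s ⊎ Fin (suc q) → Fin levels
  level (inj₁ i) = suc q ↑ʳ i
  level (inj₂ j) = j ↑ˡ s

  level-injective : Injective _≡_ _≡_ level
  level-injective {x} {y} eq = trans (sym (unlevel x)) (trans (cong (Sum.swap ∘ splitAt (suc q)) eq) (unlevel y))
    where
    unlevel : ∀ x → Sum.swap (splitAt (suc q) (level x)) ≡ x
    unlevel (inj₁ i) = cong Sum.swap (Fin.splitAt-↑ʳ (suc q) s i)
    unlevel (inj₂ j) = cong Sum.swap (Fin.splitAt-↑ˡ (suc q) j s)

  Consecutive : Fin levels → Fin levels → Set
  Consecutive i j = toℕ j ≡ suc (toℕ i) ⊎ toℕ i ≡ suc (toℕ j)

  W : Set
  W = V × Fin levels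

  Rail Rung : W → W → Set
  Rail (u , i) (v , j) = u ≡ v × Consecutive i j
  Rung (u , i) (v , j) = u ~ v × i ≡ j × level (partOf u v) ≡ i

  ladder : Graph
  ladder = record
    { V        = W
    ; size     = size ℕ.* levels
    ; finite   = ×-finite finite (↔-id _)
    ; _~_      = λ x y → Rail x y ⊎ Rung x y
    ; ~-dec    = λ (u , i) (v , j) →
        ((u ≟ v) ×-dec ((toℕ j ℕ.≟ suc (toℕ i)) ⊎-dec (toℕ i ℕ.≟ suc (toℕ j)))) ⊎-dec
        (~-dec u v ×-dec (i Fin.≟ j) ×-dec (level (partOf u v) Fin.≟ i))
    ; ~-sym    = λ { (inj₁ (refl , near)) → inj₁ (refl , Sum.swap near)
                   ; (inj₂ (e , refl , at)) → inj₂ (~-sym e , refl , trans (cong level (sym (partOf-sym e))) at) }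
    ; ~-irrefl = λ { refl (inj₁ (_ , near)) → [ ℕ.1+n≢n ∘ sym , ℕ.1+n≢n ∘ sym ]′ near
                   ; refl (inj₂ (e , _)) → ~-irrefl refl e }
    ; has-edge = let u , v , e = has-edge
                 in (u , level (partOf u v)) , (v , level (partOf u v)) , inj₂ (e , refl , refl)
    }

  module H = Graph ladder

  -- A rung changes the side in `G` and keeps the parity of the level; a rail edge does the
  -- opposite. Either way exactly one summand flips.
  side : W → Bool
  side (v , i) = isRight v xor odd (toℕ i)

  ladderSides : Sides ladder
  ladderSides = record { isRight = side ; flips = λ {x} {y} → side-flips x y }
    where
    side-flips : ∀ x y → x H.~ y → side y ≡ not (side x)
    side-flips (u , i) (v , j) (inj₂ (e , refl , _)) =
      trans (cong (_xor odd (toℕ i)) (flips e)) (sym (Bool.not-distribˡ-xor (isRight u) _))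
    side-flips (u , i) (u , j) (inj₁ (refl , inj₁ j≡1+i)) =
      trans (cong (λ k → isRight u xor odd k) j≡1+i) (sym (Bool.not-distribʳ-xor (isRight u) _))
    side-flips (u , i) (u , j) (inj₁ (refl , inj₂ i≡1+j)) = sym (trans
      (cong not (trans (cong (λ k → isRight u xor odd k) i≡1+j) (sym (Bool.not-distribʳ-xor (isRight u) _))))
      (Bool.not-involutive _))

  upper : Fin levels → Bool
  upper i = does (suc q ℕ.≤? toℕ i)

  -- Reversal depends on the side of the vertex in `G`, not on the side of its point in the ladder.
  reversed : W → Bool
  reversed (v , i) = isRight v ∧ upper i

  private
    r : V ↔ Fin size
    r = proj₁ (ranking order finite)

    rank : V → Fin size
    rank = Inverse.to r

  place : W → Fin size
  place x = orient (reversed x) (rank (proj₁ x))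

  key : W → Fin (2 ℕ.* (levels ℕ.* size))
  key x = combine (bit (side x)) (combine (proj₂ x) (place x))

  -- Side and level together determine `isRight`, hence the orientation, and `orient` is injective
  -- for a fixed orientation.
  key-injective : Injective _≡_ _≡_ key
  key-injective {x@(u , i)} {y@(v , j)} eq
    with s-eq , rest ← Fin.combine-injective (bit (side x)) _ (bit (side y)) _ eq
    with refl , p-eq ← Fin.combine-injective i (place x) j (place y) rest
    = cong (_, i) (↔-injective r (orient-injective (reversed y)
        (subst (λ b → orient (b ∧ upper i) (rank u) ≡ place y)
               (xor-cancelʳ (odd (toℕ i)) {isRight u} {isRight v} (bit-injective s-eq)) p-eq)))

  ladderOrder : VertexOrder W
  ladderOrder = orderBy key key-injective

  module H-order = Order ladderOrder

  Ahead : W → W → Set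
  Ahead x y = proj₂ x Fin.< proj₂ y ⊎ (proj₂ x ≡ proj₂ y × place x Fin.< place y)

  ahead : ∀ x y → side x ≡ side y → x H-order.< y → Ahead x y
  ahead x y s-eq lt with combine-<⁻ (bit (side x)) (bit (side y)) lt
  ... | inj₁ s-lt      = contradiction (cong bit s-eq) (Fin.<⇒≢ s-lt)
  ... | inj₂ (_ , lt′) = combine-<⁻ (proj₂ x) (proj₂ y) lt′

  -- Rungs form queue `0F`; rail edges that rise or fall from the first argument to the second form
  -- `1F` and `2F`; the stack takes the rail edges whose ends are oriented differently. The other
  -- three queues stay empty.
  colourOf : ∀ {i j : Fin levels} → Tri (i Fin.< j) (i ≡ j) (j Fin.< i) → (turning : Bool) → Fin 1 ⊎ Fin 6
  colourOf (tri≈ _ _ _) _     = inj₂ 0F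
  colourOf (tri< _ _ _) false = inj₂ 1F
  colourOf (tri> _ _ _) false = inj₂ 2F
  colourOf (tri< _ _ _) true  = inj₁ 0F
  colourOf (tri> _ _ _) true  = inj₁ 0F

  colour : W → W → Fin 1 ⊎ Fin 6
  colour x y = colourOf (Fin.<-cmp (proj₂ x) (proj₂ y)) (reversed x xor reversed y)

  data Coloured : W → W → Fin 1 ⊎ Fin 6 → Set where
    rung : ∀ {u v i} → u ~ v → level (partOf u v) ≡ i → Coloured (u , i) (v , i) (inj₂ 0F)
    up   : ∀ {v i j} → toℕ j ≡ suc (toℕ i) → reversed (v , i) ≡ reversed (v , j) →
           Coloured (v , i) (v , j) (inj₂ 1F)
    down : ∀ {v i j} → toℕ i ≡ suc (toℕ j) → reversed (v , i) ≡ reversed (v , j) →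
           Coloured (v , i) (v , j) (inj₂ 2F)
    turn : ∀ {v i j} → Consecutive i j → reversed (v , i) ≢ reversed (v , j) →
           Coloured (v , i) (v , j) (inj₁ 0F)

  xor-false : ∀ {x y} → x xor y ≡ false → x ≡ y
  xor-false {false} eq = sym eq
  xor-false {true} {true} _ = refl

  xor-true : ∀ {x y} → x xor y ≡ true → x ≢ y
  xor-true {x} eq refl = contradiction (trans (sym eq) (Bool.xor-same x)) λ ()

  coloured : ∀ {x y} → x H.~ y → Coloured x y (colour x y)
  coloured {u , i} {v , j} (inj₁ (refl , near)) with Fin.<-cmp i j | reversed (u , i) xor reversed (u , j) in eq
  ... | tri≈ _ refl _ | _ = contradiction near [ ℕ.1+n≢n ∘ sym , ℕ.1+n≢n ∘ sym ]′
  ... | tri< _ _ _ | true = turn near (xor-true eq)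
  ... | tri> _ _ _ | true = turn near (xor-true eq)
  ... | tri< i<j _ _ | false = up
      ([ id , (λ p → contradiction (subst (ℕ._< toℕ j) p i<j) (ℕ.<-asym (ℕ.n<1+n _))) ]′ near) (xor-false eq)
  ... | tri> _ _ j<i | false = down
      ([ (λ p → contradiction (subst (ℕ._< toℕ i) p j<i) (ℕ.<-asym (ℕ.n<1+n _))) , id ]′ near) (xor-false eq)
  coloured {u , i} {v , j} (inj₂ (e , refl , at)) with Fin.<-cmp i i
  ... | tri< _ i≢i _ = contradiction refl i≢i
  ... | tri≈ _ _ _   = rung e at
  ... | tri> _ i≢i _ = contradiction refl i≢i

  -- If either pair were ahead by level, `f` or `g` would put the other pair strictly behind by
  -- level. So both levels tie and only places remain to be compared.
  squeeze : ∀ {x y x′ y′} → (proj₂ x Fin.< proj₂ y → proj₂ y′ Fin.< proj₂ x′) →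
            (proj₂ x′ Fin.< proj₂ y′ → proj₂ y Fin.< proj₂ x) → Ahead x y → Ahead x′ y′ →
            (proj₂ x ≡ proj₂ y × place x Fin.< place y) × (proj₂ x′ ≡ proj₂ y′ × place x′ Fin.< place y′)
  squeeze f g (inj₂ p)  (inj₂ p′)        = p , p′
  squeeze f g (inj₁ lt) (inj₁ lt′)       = contradiction (f lt) (ℕ.<-asym lt′)
  squeeze f g (inj₁ lt) (inj₂ (eq , _))  = contradiction (f lt) (Fin.<-irrefl (sym eq))
  squeeze f g (inj₂ (eq , _)) (inj₁ lt′) = contradiction (g lt′) (Fin.<-irrefl (sym eq))

  -- Rungs of one level come from one part. On a queue level the right places are not reversed and
  -- the assumption gives a nesting in `G`; on a stack level the reversal turns it into `b < b′`, a
  -- crossing.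
  rung-mono : ∀ {a b a′ b′ i} → isRight a ≡ false → isRight a′ ≡ false → a ~ b → a′ ~ b′ →
    level (partOf a b) ≡ i → level (partOf a′ b′) ≡ i →
    rank a Fin.< rank a′ → ¬ orient (upper i) (rank b′) Fin.< orient (upper i) (rank b)
  rung-mono {a} {b} {a′} {b′} {i} left left′ e e′ at at′ a<a′ lt =
    split (partOf a b) refl (level-injective (trans at′ (sym at))) at
    where
    compare-b : ∀ {c} → upper i ≡ c → orient c (rank b′) Fin.< orient c (rank b)
    compare-b eq = subst (λ c → orient c (rank b′) Fin.< orient c (rank b)) eq lt

    split : ∀ p → partOf a b ≡ p → partOf a′ b′ ≡ partOf a b → level p ≡ i → ⊥
    split (inj₁ t) p p′ refl = stacks t (e , p) (e′ , trans p′ p)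
      ( rank-cancel order finite a<a′
      , left<right left′ (trans (flips e) (cong not left))
      , rank-cancel order finite (opposite-cancel-< (compare-b (dec-true (suc q ℕ.≤? toℕ i)
          (subst (suc q ℕ.≤_) (sym (Fin.toℕ-↑ʳ (suc q) t)) (ℕ.m≤m+n (suc q) (toℕ t)))))))
    split (inj₂ t) p p′ refl = queues t (e , p) (e′ , trans p′ p)
      ( rank-cancel order finite a<a′
      , left<right left′ (trans (flips e′) (cong not left′))
      , rank-cancel order finite (compare-b (dec-false (suc q ℕ.≤? toℕ i)
          (ℕ.<⇒≱ (subst (ℕ._< suc q) (sym (Fin.toℕ-↑ˡ t s)) (Fin.toℕ<n t))))))

  AtTurn : Fin levels → Fin levels → Set
  AtTurn i j = (toℕ i ≡ q × toℕ j ≡ suc q) ⊎ (toℕ i ≡ suc q × toℕ j ≡ q)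

  atTurn-sym : ∀ {i j} → AtTurn i j → AtTurn j i
  atTurn-sym = Sum.map swap swap ∘ Sum.swap

  -- Both edges join the levels `q` and `suc q`, so the edge that starts lower ends higher.
  atTurn-anti : ∀ {i j i′ j′} → AtTurn i j → AtTurn i′ j′ → i Fin.< i′ → j′ Fin.< j
  atTurn-anti (inj₁ (_ , eq)) (inj₂ (_ , eq′)) _  = ℕ.≤-reflexive (trans (cong suc eq′) (sym eq))
  atTurn-anti (inj₁ (eq , _)) (inj₁ (eq′ , _)) lt = contradiction lt (ℕ.<-irrefl (trans eq (sym eq′)))
  atTurn-anti (inj₂ (eq , _)) (inj₂ (eq′ , _)) lt = contradiction lt (ℕ.<-irrefl (trans eq (sym eq′)))
  atTurn-anti (inj₂ (eq , _)) (inj₁ (eq′ , _)) lt =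
    contradiction lt (ℕ.<-asym (ℕ.≤-reflexive (trans (cong suc eq′) (sym eq))))

  -- Left vertices are never reversed, and `upper` changes its value only between the levels `q` and
  -- `suc q`.
  turn-levels : ∀ {v i j} → Consecutive i j → reversed (v , i) ≢ reversed (v , j) →
    isRight v ≡ true × upper i ≢ upper j × AtTurn i j
  turn-levels {v} {i} {j} near ne with isRight v
  ... | false = contradiction refl ne
  ... | true  = refl , ne , at (suc q ℕ.≤? toℕ i) (suc q ℕ.≤? toℕ j) near
    where
    just-above : ∀ {m n} → suc q ℕ.≤ m → ¬ suc q ℕ.≤ n → m ≡ suc n → m ≡ suc q × n ≡ q
    just-above m≥ n< m≡
      with refl ← ℕ.≤-antisym (ℕ.≮⇒≥ n<) (ℕ.s≤s⁻¹ (subst (suc q ℕ.≤_) m≡ m≥))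
      = m≡ , refl

    not-below : ∀ {m n} → suc q ℕ.≤ m → ¬ suc q ℕ.≤ n → n ≢ suc m
    not-below m≥ n< n≡ = n< (subst (suc q ℕ.≤_) (sym n≡) (ℕ.m≤n⇒m≤1+n m≥))

    at : Dec (suc q ℕ.≤ toℕ i) → Dec (suc q ℕ.≤ toℕ j) → Consecutive i j → AtTurn i j
    at (yes i≥) (yes j≥) _ = contradiction
      (trans (dec-true (suc q ℕ.≤? toℕ i) i≥) (sym (dec-true (suc q ℕ.≤? toℕ j) j≥))) ne
    at (no i<)  (no j<)  _ = contradiction
      (trans (dec-false (suc q ℕ.≤? toℕ i) i<) (sym (dec-false (suc q ℕ.≤? toℕ j) j<))) ne
    at (yes i≥) (no j<)  (inj₁ j≡) = contradiction j≡ (not-below i≥ j<)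
    at (yes i≥) (no j<)  (inj₂ i≡) = inj₂ (just-above i≥ j< i≡)
    at (no i<)  (yes j≥) (inj₁ j≡) = inj₁ (swap (just-above j≥ i< j≡))
    at (no i<)  (yes j≥) (inj₂ i≡) = contradiction i≡ (not-below j≥ i<)

  place-right : ∀ {v} i → isRight v ≡ true → place (v , i) ≡ orient (upper i) (rank v)
  place-right {v} i right = cong (λ b → orient (b ∧ upper i) (rank v)) right

  place-left : ∀ {v} i → isRight v ≡ false → place (v , i) ≡ rank v
  place-left {v} i left = cong (λ b → orient (b ∧ upper i) (rank v)) left

  -- After `squeeze` the two edges join the same pair of levels, and the places at one pair of ends
  -- occur in reverse at the other.
  no-turn-crossing : ∀ {x y x′ y′ c} → Coloured x y (inj₁ c) → Coloured x′ y′ (inj₁ c) →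
                     Ahead x x′ → ¬ Ahead y y′
  no-turn-crossing {v , i} {_ , j} {v′ , i′} {_ , j′} (turn near ne) (turn near′ ne′) x<x′ y<y′
    with v-right , upper≢ , at  ← turn-levels near ne
       | v′-right , _ , at′ ← turn-levels near′ ne′
    with (refl , p) , (refl , p′) ← squeeze
           (atTurn-anti at at′) (atTurn-anti (atTurn-sym at) (atTurn-sym at′)) x<x′ y<y′
    = ℕ.<-asym (subst₂ Fin._<_ (place-right j v-right) (place-right j v′-right) p′)
        (orient-anti-< upper≢ (subst₂ Fin._<_ (place-right i v-right) (place-right i v′-right) p))

  no-rail-nesting : ∀ {v i j v′} → reversed (v , i) ≡ reversed (v , j) → reversed (v′ , i) ≡ reversed (v′ , j) →
    place (v , i) Fin.< place (v′ , i) → ¬ place (v′ , j) Fin.< place (v , j)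
  no-rail-nesting {v} {v′ = v′} eq eq′ lt lt′ = ℕ.<-asym lt′
    (subst₂ (λ b b′ → orient b (rank v) Fin.< orient b′ (rank v′)) eq eq′ lt)

  no-nesting : ∀ {x y x′ y′ c} → side x ≡ side x′ → Coloured x y (inj₂ c) → Coloured x′ y′ (inj₂ c) →
               Ahead x x′ → ¬ Ahead y′ y
  no-nesting _ (up {v} {i} {j} j≡ eq) (up j′≡ eq′) x<x′ y′<y
    -- Levels rise by one along both edges, so the two ends compare alike by level, while a nesting
    -- needs opposite comparisons.
    with (refl , p) , (y≡ , p′) ← squeeze
           (λ lt → subst₂ ℕ._<_ (sym j≡) (sym j′≡) (s≤s lt))
           (λ lt → ℕ.s≤s⁻¹ (subst₂ ℕ._<_ j′≡ j≡ lt)) x<x′ y′<y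
    with refl ← y≡
    = no-rail-nesting {v} {i} {j} eq eq′ p p′
  no-nesting _ (down {v} {i} {j} i≡ eq) (down i′≡ eq′) x<x′ y′<y
    with (refl , p) , (y≡ , p′) ← squeeze
           (λ lt → ℕ.s≤s⁻¹ (subst₂ ℕ._<_ i≡ i′≡ lt))
           (λ lt → subst₂ ℕ._<_ (sym i′≡) (sym i≡) (s≤s lt)) x<x′ y′<y
    with refl ← y≡
    = no-rail-nesting {v} {i} {j} eq eq′ p p′
  no-nesting {u , i} {w , _} {u′ , _} {w′ , _} s-eq (rung e at) (rung e′ at′) x<x′ y′<y
    with (refl , p) , (_ , p′) ← squeeze id id x<x′ y′<y
    with isRight u in u-side | xor-cancelʳ (odd (toℕ i)) {isRight u} {isRight u′} s-eq
  ... | false | u≡u′ = rung-mono u-side (sym u≡u′) e e′ at at′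
      (subst₂ Fin._<_ refl (place-left i (sym u≡u′)) p)
      (subst₂ Fin._<_ (place-right i (trans (flips e′) (cong not (sym u≡u′))))
                      (place-right i (trans (flips e) (cong not u-side))) p′)
  -- The first ends are right vertices of `G`, so both rungs are read backwards and exchange their
  -- roles.
  ... | true | u≡u′ = rung-mono w′-left w-left (~-sym e′) (~-sym e)
      (trans (cong level (sym (partOf-sym e′))) at′) (trans (cong level (sym (partOf-sym e))) at)
      (subst₂ Fin._<_ (place-left i w′-left) (place-left i w-left) p′)
      (subst₂ Fin._<_ refl (place-right i (sym u≡u′)) p)
    where
    w-left : isRight w ≡ false
    w-left = trans (flips e) (cong not u-side)
    w′-left : isRight w′ ≡ false
    w′-left = trans (flips e′) (cong not (sym u≡u′))

  ladderLayout : SidedStackQueueLayout ladder 1 6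
  ladderLayout = sidedLayout ladderSides ladderOrder
    (λ {x} {y} l r → Fin.combine-monoˡ-< (combine (proj₂ x) (place x)) (combine (proj₂ y) (place y)) (bit-< l r))
    colour
    (λ {a} {b} {a′} {b′} l l′ e e′ c c′ lt lt′ → no-turn-crossing
      (subst (Coloured a b) c (coloured e)) (subst (Coloured a′ b′) c′ (coloured e′))
      (ahead a a′ (trans l (sym l′)) lt) (ahead b b′ (opposite-sides l l′ e e′) lt′))
    (λ {a} {b} {a′} {b′} l l′ e e′ c c′ lt lt′ → no-nesting (trans l (sym l′))
      (subst (Coloured a b) c (coloured e)) (subst (Coloured a′ b′) c′ (coloured e′))
      (ahead a a′ (trans l (sym l′)) lt) (ahead b′ b (sym (opposite-sides l l′ e e′)) lt′))
    where
    opposite-sides : ∀ {a b a′ b′} → side a ≡ false → side a′ ≡ false → a H.~ b → a′ H.~ b′ → side b ≡ side b′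
    opposite-sides {a} {b} {a′} {b′} l l′ e e′ = trans (Sides.flips ladderSides {a} {b} e)
      (trans (cong not (trans l (sym l′))) (sym (Sides.flips ladderSides {a′} {b′} e′)))

  -- From a queue layout of the ladder back to one of the original graph.

  module _ {k : ℕ} (M : QueueLayout ladder k) where
    private
      module M where
        open QueueLayout M public
        open Order (QueueLayout.order M) public

      climb : V → Fin ((k ℕ.* 2) ℕ.^ (q ℕ.+ s))
      climb v = funToFin (λ i → edgeInfo M (v , inject₁ i) (v , suc i))

      -- Each pair of parallel rail edges is monotone by `edgeInfo-mono`. The inequality stays
      -- strict because rails of distinct vertices are disjoint.
      climb-mono : ∀ {v v′} → climb v ≡ climb v′ → (v , zero) M.< (v′ , zero) → ∀ i → (v , i) M.< (v′ , i)
      climb-mono {v} {v′} eq lt = <-weakInduction (λ i → (v , i) M.< (v′ , i)) lt step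
        where
        step : ∀ i → (v , inject₁ i) M.< (v′ , inject₁ i) → (v , suc i) M.< (v′ , suc i)
        step i lt-i with M.compare (v , suc i) (v′ , suc i)
        ... | tri< lt′ _ _ = lt′
        ... | tri≈ _ refl _ = contradiction lt (M.irrefl refl)
        ... | tri> _ _ gt = contradiction gt (edgeInfo-mono M railEdge railEdge info-eq lt-i)
          where
          railEdge : ∀ {x} → (x , inject₁ i) H.~ (x , suc i)
          railEdge = inj₁ (refl , inj₁ (cong suc (sym (Fin.toℕ-inject₁ i))))
          info-eq : edgeInfo M (v , inject₁ i) (v , suc i) ≡ edgeInfo M (v′ , inject₁ i) (v′ , suc i)
          info-eq = trans (sym (Fin.finToFun-funToFin _ i))
            (trans (cong (λ c → finToFun c i) eq) (Fin.finToFun-funToFin _ i))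

      rungInfo : V → V → Fin (k ℕ.* 2)
      rungInfo a b = edgeInfo M (a , level (partOf a b)) (b , level (partOf a b))

      pathColour : V → V →
        Fin (levels ℕ.* (k ℕ.* 2 ℕ.* ((k ℕ.* 2) ℕ.^ (q ℕ.+ s) ℕ.* (k ℕ.* 2) ℕ.^ (q ℕ.+ s))))
      pathColour a b = combine (level (partOf a b)) (combine (rungInfo a b) (combine (climb a) (climb b)))

      -- An edge becomes the path up the rail of `a`, across its rung and down the rail of `b`. Both
      -- assumed inequalities are carried up to the common rung level `ℓ`, where they contradict
      -- monotonicity of the rungs.
      path-mono : ∀ {a b a′ b′} → a ~ b → a′ ~ b′ → pathColour a b ≡ pathColour a′ b′ →
                  (a , zero) M.< (a′ , zero) → ¬ (b′ , zero) M.< (b , zero)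
      path-mono {a} {b} {a′} {b′} e e′ eq a<a′ b′<b
        with lev , eq₁ ← Fin.combine-injective (level (partOf a b)) _ (level (partOf a′ b′)) _ eq
        with info , eq₂ ← Fin.combine-injective (rungInfo a b) _ (rungInfo a′ b′) _ eq₁
        with climbs , climbs′ ← Fin.combine-injective (climb a) _ (climb a′) _ eq₂
        = edgeInfo-mono M {a , ℓ} {b , ℓ} {a′ , ℓ} {b′ , ℓ} (inj₂ (e , refl , refl)) (inj₂ (e′ , refl , sym lev))
            (trans info (cong (λ i → edgeInfo M (a′ , i) (b′ , i)) (sym lev)))
            (climb-mono climbs a<a′ ℓ) (climb-mono (sym climbs′) b′<b ℓ)
        where ℓ = level (partOf a b)

    unladder : QueueLayout G (ladderBound k (q ℕ.+ s))
    unladder = monotoneLayout sides (pullback M.order (_, zero) (cong proj₁)) pathColour (λ _ _ → path-mono)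

-- The cycle of implications.

sixQueue⇒separated : OneStackSixQueueBounded → SeparatedBounded
-- With `q` queue levels and `s` stack levels a rail has one edge fewer than levels, hence
-- `pred q + s`.
sixQueue⇒separated (C , bounded) = (λ s q → ladderBound C (ℕ.pred q ℕ.+ s)) ,
  λ { s (suc q) _ _ G sep →
    let open Ladder (sided sep)
    in queueLayout⇒queueNumber (unladder (queueNumber⇒queueLayout (bounded ladder (unsided ladderLayout)))) }

separated⇒oneStack : SeparatedBounded → OneStackBounded
separated⇒oneStack (f , bounded) = f 1 , λ q → bounded 1 q (s≤s z≤n)

oneStack⇒sixQueue : OneStackBounded → OneStackSixQueueBounded
oneStack⇒sixQueue (f , bounded) = f 6 , bounded 6 (s≤s z≤n)

theorem5 : (SeparatedBounded ⇔ SamePermutationBounded) ×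
    (SamePermutationBounded ⇔ OneStackBounded) ×
    (OneStackBounded ⇔ OneStackSixQueueBounded)
theorem5 =
  mk⇔ separated⇒samePermutation samePermutation⇒separated ,
  mk⇔ (separated⇒oneStack ∘ samePermutation⇒separated)
      (separated⇒samePermutation ∘ sixQueue⇒separated ∘ oneStack⇒sixQueue) ,
  mk⇔ oneStack⇒sixQueue (separated⇒oneStack ∘ sixQueue⇒separated)
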